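{- Let $\mathcal A$ be a $k$-algebra and let $\Delta:\mathcal A\to\mathcal A\otimes\mathcal A$ be a comultiplication which is a morphism of algebras. Then: (i) If $k$ is a field, the Sweedler dual $\mathcal A^\circ$ of $\mathcal A$ is closed under the dual law ${}^t\Delta$, i.e. $f,g\in\mathcal A^\circ$ implies ${}^t\Delta(f,g)\in\mathcal A^\circ$. (ii) If $k$ is a semiring and $\mathcal A=k\langle X\rangle$ for a set $X$, then $\mathcal A^\circ$ is closed under the dual law ${}^t\Delta$.
   Context: A semiring $(k,+,\times)$ is a set with two laws such that $(k,+)$ is a commutative monoid with neutral $0_k$, $(k,\times)$ is a monoid (not required to be commutative) with neutral $1_k$, $\times$ distributes over $+$ on both sides, and $0_k$ is annihilating. Modules and algebras over a semiring are defined following the pattern for rings, the underlying additive structure being only a commutative monoid. Algebras are associative with unit. A comultiplication on $\mathcal A$ is a $k$-linear map $\Delta:\mathcal A\to\mathcal A\otimes\mathcal A$ (not assumed coassociative or counital), where $\mathcal A\otimes\mathcal A$ carries the product $(a\otimes b)(c\otimes d)=ac\otimes bd$. $\mathcal A^*$ denotes the set of $k$-linear forms on $\mathcal A$. The dual law ${}^t\Delta$ on $\mathcal A^*$ is given by ${}^t\Delta(f,g)(x)=(f\otimes g)(\Delta(x))$, where $(f\otimes g)(a\otimes b)=f(a)g(b)$. For a semiring $k$ and a set $X$, $X^*$ is the free monoid on $X$ and $k\langle X\rangle$ is the algebra of noncommutative polynomials, i.e. finitely supported functions $X^*\to k$ with convolution product. Linear forms on $k\langle X\rangle$ are identified with functions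 $X^*\to k$. The elements of $k\langle X\rangle\otimes k\langle X\rangle$ are the finite sums $\sum_{u,v\in X^*}c_{u,v}\,u\otimes v$ with $c_{u,v}\in k$, and if $\Delta(w)=\sum_{u,v}c_{u,v}\,u\otimes v$ for a word $w$, then ${}^t\Delta(f,g)(w)=\sum_{u,v}c_{u,v}f(u)g(v)$. Sweedler's dual $\mathcal A^\circ$: - If $k$ is a field, $\mathcal A^\circ$ is the set of $f\in\mathcal A^*$ for which there exist an integer $n$, $\lambda\in k^{1\times n}$, $\gamma\in k^{n\times1}$ and a morphism of unital $k$-algebras $\mu:\mathcal A\to k^{n\times n}$ with $f(x)=\lambda\mu(x)\gamma$ for all $x\in\mathcal A$ (equivalently, $(x,y)\mapsto f(xy)$ is of the form $\sum_{i=1}^n g_i(x)h_i(y)$ with $g_i,h_i\in\mathcal A^*$). - If $k$ is a semiring and $\mathcal A=k\langle X\rangle$, $\mathcal A^\circ$ is the set of $f:X^*\to k$ for which there exist an integer $n$, $\lambda\in k^{1\times n}$, $\gamma\in k^{n\times1}$ and a morphism of monoids $\mu:X^*\to(k^{n\times n},\times)$ with $f(w)=\lambda\mu(w)\gamma$ for all $w\in X^*$.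
   Formalization: In (ii) k⟨X⟩ is required to satisfy the k-algebra axioms, which forces the semiring k to be commutative (for noncommutative k the product on the tensor square is ill-defined and the claim fails); the set X is assumed to have decidable equality, which is automatic classically. -}

module Defs where

open import Algebra.Bundles using (Semiring; RawSemiring; CommutativeMonoid; CommutativeRing)
open import Algebra.Definitions using (Commutative)
open import Algebra.Definitions.RawMonoid using () renaming (sum to rawSum)
open import Algebra.Module.Bundles.Raw using (RawLeftSemimodule)
import Algebra.Module.Construct.TensorUnit as TensorUnit
open import Algebra.Module.Morphism.Structures using (module LeftSemimoduleMorphisms)
open import Algebra.Module.Structures using (IsLeftSemimodule)
open import Algebra.Morphism.Structures using (module MonoidMorphisms; module SemiringMorphisms)
open import Algebra.Structures using (IsSemiring; IsCommutativeMonoid)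
open import Data.Bool.Base using (if_then_else_)
open import Data.Fin.Base using (Fin; zero)
import Data.Fin.Properties as Fin
open import Data.List.Base
  using (List; []; _∷_; [_]; _++_; map; foldr; cartesianProductWith; ++-[]-rawMonoid)
open import Data.List.Membership.Propositional using (_∉_)
import Data.List.Membership.DecPropositional as DecMembership
open import Data.List.Membership.Propositional.Properties
  using (∈-++⁺ˡ; ∈-++⁺ʳ; ∈-cartesianProductWith⁺)
open import Data.List.Properties using (≡-dec)
open import Data.List.Relation.Unary.Any using (here)
open import Data.Nat.Base using (ℕ)
open import Data.Product.Base using (∃; ∃-syntax; _×_; _,_; map₁)
open import Function.Base using (_∘_)
open import Level using (Level; _⊔_; suc)
open import Relation.Binary.Core using (Rel)
open import Relation.Binary.Definitions using (DecidableEquality)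
open import Relation.Binary.PropositionalEquality.Core as ≡ using (_≡_)
open import Relation.Nullary using (¬_; does; yes; no; contradiction)
open import Relation.Unary using (Pred)
import Relation.Binary.Reasoning.Setoid as SetoidReasoning
import Algebra.Properties.CommutativeSemigroup as CommutativeSemigroupProperties

private variable
  c ℓ a b ℓa ℓb x : Level

record Field (c ℓ : Level) : Set (suc (c ⊔ ℓ)) where
  field
    commutativeRing : CommutativeRing c ℓ
  open CommutativeRing commutativeRing public
  field
    1≉0      : ¬ (1# ≈ 0#)
    inverses : ∀ r → ¬ (r ≈ 0#) → ∃[ s ] r * s ≈ 1#

record RawAlgebra (R : Set c) (a ℓa : Level) : Set (c ⊔ suc (a ⊔ ℓa)) where
  infixr 8 _·_
  field
    rawSemiring : RawSemiring a ℓa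
  open RawSemiring rawSemiring public
  field
    _·_ : R → Carrier → Carrier

  rawLeftSemimodule : RawLeftSemimodule R a ℓa
  rawLeftSemimodule = record
    { _≈ᴹ_ = _≈_
    ; _+ᴹ_ = _+_
    ; _*ₗ_ = _·_
    ; 0ᴹ   = 0#
    }

module _ (k : Semiring c ℓ) where
  private module k = Semiring k

  record IsAlgebra (A : RawAlgebra k.Carrier a ℓa) : Set (c ⊔ ℓ ⊔ a ⊔ ℓa) where
    open RawAlgebra A
    field
      isSemiring       : IsSemiring _≈_ _+_ _*_ 0# 1#
      isLeftSemimodule : IsLeftSemimodule k _≈_ _+_ 0# _·_
      ·-*-assocˡ       : ∀ r x y → (r · x) * y ≈ r · (x * y)
      ·-*-assocʳ       : ∀ r x y → x * (r · y) ≈ r · (x * y)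

  record Algebra (a ℓa : Level) : Set (c ⊔ ℓ ⊔ suc (a ⊔ ℓa)) where
    field
      rawAlgebra : RawAlgebra k.Carrier a ℓa
      isAlgebra  : IsAlgebra rawAlgebra
    open RawAlgebra rawAlgebra public
    open IsAlgebra isAlgebra public

module _ {R : Set c} (A : RawAlgebra R a ℓa) (B : RawAlgebra R b ℓb) where
  private
    module A = RawAlgebra A
    module B = RawAlgebra B
  open SemiringMorphisms A.rawSemiring B.rawSemiring using (IsSemiringHomomorphism)
  open LeftSemimoduleMorphisms A.rawLeftSemimodule B.rawLeftSemimodule
    using (IsLeftSemimoduleHomomorphism)

  record IsAlgebraHomomorphism (φ : A.Carrier → B.Carrier) : Set (c ⊔ a ⊔ ℓa ⊔ ℓb) where
    field
      isSemiringHomomorphism       : IsSemiringHomomorphism φ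
      isLeftSemimoduleHomomorphism : IsLeftSemimoduleHomomorphism φ

module _ (k : Semiring c ℓ) where
  open Semiring k
    using (Carrier; _≈_; _+_; _*_; 0#; 1#; rawSemiring; +-rawMonoid)

  Matrix : ℕ → ℕ → Set c
  Matrix m n = Fin m → Fin n → Carrier

  infixl 7 _*ₘ_
  _*ₘ_ : ∀ {m n p} → Matrix m n → Matrix n p → Matrix m p
  (M *ₘ N) i j = rawSum +-rawMonoid (λ l → M i l * N l j)

  matrixAlgebra : ℕ → RawAlgebra Carrier c ℓ
  matrixAlgebra n = record
    { rawSemiring = record
      { Carrier = Matrix n n
      ; _≈_     = λ M N → ∀ i j → M i j ≈ N i j
      ; _+_     = λ M N i j → M i j + N i j
      ; _*_     = _*ₘ_
      ; 0#      = λ _ _ → 0#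
      ; 1#      = λ i j → if does (i Fin.≟ j) then 1# else 0#
      }
    ; _·_ = λ r M i j → r * M i j
    }

  rowMatrixColumn : ∀ {n} → Matrix 1 n → Matrix n n → Matrix n 1 → Carrier
  rowMatrixColumn lam M gam = (lam *ₘ M *ₘ gam) zero zero

  module _ (A : Algebra k a ℓa) where
    private module A = Algebra A

    open LeftSemimoduleMorphisms A.rawLeftSemimodule
      (TensorUnit.rawLeftSemimodule {R = rawSemiring})
      public using () renaming (IsLeftSemimoduleHomomorphism to IsLinearForm)

    -- An element of A ⊗ A is a list of pure tensors, read as their sum; ≈⊗ is
    -- the least congruence making this commutative, and ⊗ bilinear.
    infix 4 _≈⊗_
    data _≈⊗_ : Rel (List (A.Carrier × A.Carrier)) (c ⊔ a ⊔ ℓa) where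
      ≈⊗-refl   : ∀ {s} → s ≈⊗ s
      ≈⊗-sym    : ∀ {s t} → s ≈⊗ t → t ≈⊗ s
      ≈⊗-trans  : ∀ {s t u} → s ≈⊗ t → t ≈⊗ u → s ≈⊗ u
      ++-cong   : ∀ {s s′ t t′} → s ≈⊗ s′ → t ≈⊗ t′ → s ++ t ≈⊗ s′ ++ t′
      ++-comm   : ∀ s t → s ++ t ≈⊗ t ++ s
      ⊗-cong    : ∀ {x x′ y y′} → x A.≈ x′ → y A.≈ y′ → [ x , y ] ≈⊗ [ x′ , y′ ]
      +-⊗       : ∀ x x′ y → [ x A.+ x′ , y ] ≈⊗ (x , y) ∷ (x′ , y) ∷ []
      ⊗-+       : ∀ x y y′ → [ x , y A.+ y′ ] ≈⊗ (x , y) ∷ (x , y′) ∷ []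
      0-⊗       : ∀ y → [ A.0# , y ] ≈⊗ []
      ⊗-0       : ∀ x → [ x , A.0# ] ≈⊗ []
      ·-⊗       : ∀ r x y → [ r A.· x , y ] ≈⊗ [ x , r A.· y ]

    tensorSquare : RawAlgebra Carrier a (c ⊔ a ⊔ ℓa)
    tensorSquare = record
      { rawSemiring = record
        { Carrier = List (A.Carrier × A.Carrier)
        ; _≈_     = _≈⊗_
        ; _+_     = _++_
        ; _*_     = cartesianProductWith (λ (x , y) (z , t) → x A.* z , y A.* t)
        ; 0#      = []
        ; 1#      = [ A.1# , A.1# ]
        }
      ; _·_ = λ r → map (map₁ (r A.·_))
      }

    tensorForm : (f g : A.Carrier → Carrier) → List (A.Carrier × A.Carrier) → Carrier
    tensorForm f g = foldr (λ (x , y) s → f x * g y + s) 0#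

    dualLaw : (A.Carrier → List (A.Carrier × A.Carrier)) →
              (f g : A.Carrier → Carrier) → A.Carrier → Carrier
    dualLaw Δ f g x = tensorForm f g (Δ x)

    SweedlerDual : Pred (A.Carrier → Carrier) (c ⊔ ℓ ⊔ a ⊔ ℓa)
    SweedlerDual f = IsLinearForm f ×
      (∃[ n ] ∃ λ (lam : Matrix 1 n) → ∃ λ (gam : Matrix n 1) →
       ∃ λ (μ : A.Carrier → Matrix n n) →
         IsAlgebraHomomorphism A.rawAlgebra (matrixAlgebra n) μ ×
         (∀ x → f x ≈ rowMatrixColumn lam (μ x) gam))

module _ (k : Semiring c ℓ) {X : Set x} (_≟_ : DecidableEquality X) where
  open Semiring k hiding (zero)
  open DecMembership (≡-dec _≟_) using (_∈?_)

  record Polynomial : Set (c ⊔ ℓ ⊔ x) where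
    field
      coeff   : List X → Carrier
      support : List (List X)
      vanish  : ∀ w → w ∉ support → coeff w ≈ 0#
  open Polynomial

  -- The sum of p u * q v over all factorisations w = u v, the one with u
  -- empty coming first.
  convolution : (p q : List X → Carrier) → List X → Carrier
  convolution p q []      = p [] * q []
  convolution p q (x ∷ w) = p [] * q (x ∷ w) + convolution (p ∘ (x ∷_)) q w

  private
    convolution-vanish : ∀ p q w → (∀ u v → u ++ v ≡ w → p u * q v ≈ 0#) →
                         convolution p q w ≈ 0#
    convolution-vanish p q []      h = h [] [] ≡.refl
    convolution-vanish p q (x ∷ w) h = trans
      (+-cong (h [] (x ∷ w) ≡.refl)
              (convolution-vanish _ q w (λ u v e → h (x ∷ u) v (≡.cong (x ∷_) e))))
      (+-identityˡ 0#)

    *-vanish : ∀ p q w → w ∉ cartesianProductWith _++_ (support p) (support q) →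
               ∀ u v → u ++ v ≡ w → coeff p u * coeff q v ≈ 0#
    *-vanish p q w w∉ u v ≡.refl with u ∈? support p | v ∈? support q
    ... | yes u∈ | yes v∈ = contradiction (∈-cartesianProductWith⁺ _++_ u∈ v∈) w∉
    ... | no u∉  | _      = trans (*-congʳ (vanish p u u∉)) (zeroˡ _)
    ... | yes _  | no v∉  = trans (*-congˡ (vanish q v v∉)) (zeroʳ _)

  word : List X → Polynomial
  word u = record
    { coeff   = λ w → if does (≡-dec _≟_ w u) then 1# else 0#
    ; support = [ u ]
    ; vanish  = outside
    }
    where
    outside : ∀ w → w ∉ [ u ] → (if does (≡-dec _≟_ w u) then 1# else 0#) ≈ 0#
    outside w w∉ with ≡-dec _≟_ w u
    ... | yes w≡u = contradiction (here w≡u) w∉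
    ... | no  _   = refl

  polynomialAlgebra : RawAlgebra Carrier (c ⊔ ℓ ⊔ x) (ℓ ⊔ x)
  polynomialAlgebra = record
    { rawSemiring = record
      { Carrier = Polynomial
      ; _≈_     = λ p q → ∀ w → coeff p w ≈ coeff q w
      ; _+_     = λ p q → record
        { coeff   = λ w → coeff p w + coeff q w
        ; support = support p ++ support q
        ; vanish  = λ w w∉ → trans
            (+-cong (vanish p w (w∉ ∘ ∈-++⁺ˡ)) (vanish q w (w∉ ∘ ∈-++⁺ʳ (support p))))
            (+-identityˡ 0#)
        }
      ; _*_     = λ p q → record
        { coeff   = convolution (coeff p) (coeff q)
        ; support = cartesianProductWith _++_ (support p) (support q)
        ; vanish  = λ w w∉ → convolution-vanish _ _ w (*-vanish p q w w∉)
        }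
      ; 0#      = record { coeff = λ _ → 0# ; support = [] ; vanish = λ _ _ → refl }
      ; 1#      = word []
      }
    ; _·_ = λ r p → record
      { coeff   = λ w → r * coeff p w
      ; support = support p
      ; vanish  = λ w w∉ → trans (*-congˡ (vanish p w w∉)) (zeroʳ r)
      }
    }

  -- Every axiom other than x * (r · y) ≈ r · (x * y) holds for an arbitrary
  -- semiring k; that one, on constant polynomials, says that k is commutative.
  isAlgebra⇒comm : IsAlgebra k polynomialAlgebra → Commutative _≈_ _*_
  isAlgebra⇒comm alg r s = begin
    r * s                ≈⟨ *-cong (*-identityʳ r) (*-identityʳ s) ⟨
    (r * 1#) * (s * 1#)  ≈⟨ IsAlgebra.·-*-assocʳ alg s (r · word []) (word []) [] ⟩
    s * ((r * 1#) * 1#)  ≈⟨ *-congˡ (trans (*-identityʳ _) (*-identityʳ r)) ⟩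
    s * r                ∎
    where
    open RawAlgebra polynomialAlgebra using (_·_)
    open SetoidReasoning setoid

  comm⇒isAlgebra : Commutative _≈_ _*_ → IsAlgebra k polynomialAlgebra
  comm⇒isAlgebra *-comm = record
    { isSemiring = record
      { isSemiringWithoutAnnihilatingZero = record
        { +-isCommutativeMonoid = +-isCM
        ; *-cong     = λ p≈ q≈ → conv-cong p≈ q≈
        ; *-assoc    = λ p q r → conv-assoc (coeff p) (coeff q) (coeff r)
        ; *-identity = (λ p → conv-identityˡ (coeff p)) , (λ p → conv-identityʳ (coeff p))
        ; distrib    = (λ p q r → conv-distribˡ (coeff p) (coeff q) (coeff r))
                     , (λ p q r → conv-distribʳ (coeff q) (coeff r) (coeff p))
        }
      ; zero = (λ p → conv-zeroˡ (coeff p)) , (λ p → conv-zeroʳ (coeff p))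
      }
    ; isLeftSemimodule = record
      { +ᴹ-isCommutativeMonoid = +-isCM
      ; isPreleftSemimodule = record
        { *ₗ-cong      = λ r≈ p≈ w → *-cong r≈ (p≈ w)
        ; *ₗ-zeroˡ     = λ p w → zeroˡ _
        ; *ₗ-distribʳ  = λ p r s w → distribʳ _ r s
        ; *ₗ-identityˡ = λ p w → *-identityˡ _
        ; *ₗ-assoc     = λ r s p w → *-assoc r s _
        ; *ₗ-zeroʳ     = λ r w → zeroʳ r
        ; *ₗ-distribˡ  = λ r p q w → distribˡ r _ _
        }
      }
    ; ·-*-assocˡ = λ r p q → conv-scaleˡ r (coeff p) (coeff q)
    ; ·-*-assocʳ = λ r p q → conv-scaleʳ r (coeff p) (coeff q)
    }
    where
    open CommutativeSemigroupProperties
      (CommutativeMonoid.commutativeSemigroup +-commutativeMonoid) using (interchange)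
    module P = RawAlgebra polynomialAlgebra
    open SetoidReasoning setoid
    conv = convolution

    +-isCM : IsCommutativeMonoid P._≈_ P._+_ P.0#
    +-isCM = record
      { isMonoid = record
        { isSemigroup = record
          { isMagma = record
            { isEquivalence = record
              { refl  = λ w → refl
              ; sym   = λ p≈q w → sym (p≈q w)
              ; trans = λ p≈q q≈r w → trans (p≈q w) (q≈r w)
              }
            ; ∙-cong = λ p≈ q≈ w → +-cong (p≈ w) (q≈ w)
            }
          ; assoc = λ p q r w → +-assoc _ _ _
          }
        ; identity = (λ p w → +-identityˡ _) , (λ p w → +-identityʳ _)
        }
      ; comm = λ p q w → +-comm _ _
      }

    conv-cong : ∀ {p p′ q q′} → (∀ w → p w ≈ p′ w) → (∀ w → q w ≈ q′ w) →
                ∀ w → conv p q w ≈ conv p′ q′ w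
    conv-cong p≈ q≈ []      = *-cong (p≈ []) (q≈ [])
    conv-cong p≈ q≈ (x ∷ w) =
      +-cong (*-cong (p≈ []) (q≈ (x ∷ w))) (conv-cong (p≈ ∘ (x ∷_)) q≈ w)

    conv-zeroˡ : ∀ q w → conv (λ _ → 0#) q w ≈ 0#
    conv-zeroˡ q w = convolution-vanish _ q w (λ _ _ _ → zeroˡ _)

    conv-zeroʳ : ∀ p w → conv p (λ _ → 0#) w ≈ 0#
    conv-zeroʳ p w = convolution-vanish p _ w (λ _ _ _ → zeroʳ _)

    conv-distribʳ : ∀ p q r w → conv (λ u → p u + q u) r w ≈ conv p r w + conv q r w
    conv-distribʳ p q r []      = distribʳ _ _ _
    conv-distribʳ p q r (x ∷ w) =
      trans (+-cong (distribʳ _ _ _) (conv-distribʳ _ _ r w)) (interchange _ _ _ _)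

    conv-distribˡ : ∀ p q r w → conv p (λ u → q u + r u) w ≈ conv p q w + conv p r w
    conv-distribˡ p q r []      = distribˡ _ _ _
    conv-distribˡ p q r (x ∷ w) =
      trans (+-cong (distribˡ _ _ _) (conv-distribˡ _ q r w)) (interchange _ _ _ _)

    conv-scaleˡ : ∀ r p q w → conv (λ u → r * p u) q w ≈ r * conv p q w
    conv-scaleˡ r p q []      = *-assoc _ _ _
    conv-scaleˡ r p q (x ∷ w) =
      trans (+-cong (*-assoc _ _ _) (conv-scaleˡ r _ q w)) (sym (distribˡ _ _ _))

    swap : ∀ r s t → s * (r * t) ≈ r * (s * t)
    swap r s t = trans (sym (*-assoc s r t)) (trans (*-congʳ (*-comm s r)) (*-assoc r s t))

    conv-scaleʳ : ∀ r p q w → conv p (λ u → r * q u) w ≈ r * conv p q w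
    conv-scaleʳ r p q []      = swap r _ _
    conv-scaleʳ r p q (x ∷ w) =
      trans (+-cong (swap r _ _) (conv-scaleʳ r _ q w)) (sym (distribˡ _ _ _))

    conv-assoc : ∀ p q r w → conv (conv p q) r w ≈ conv p (conv q r) w
    conv-assoc p q r []      = *-assoc _ _ _
    conv-assoc p q r (x ∷ w) = begin
      (p [] * q []) * r (x ∷ w) + conv (λ u → p [] * qₓ u + conv pₓ q u) r w
        ≈⟨ +-cong (*-assoc _ _ _) (conv-distribʳ _ _ r w) ⟩
      p [] * (q [] * r (x ∷ w)) + (conv (λ u → p [] * qₓ u) r w + conv (conv pₓ q) r w)
        ≈⟨ +-assoc _ _ _ ⟨
      (p [] * (q [] * r (x ∷ w)) + conv (λ u → p [] * qₓ u) r w) + conv (conv pₓ q) r w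
        ≈⟨ +-cong (trans (+-congˡ (conv-scaleˡ _ qₓ r w)) (sym (distribˡ _ _ _)))
                  (conv-assoc pₓ q r w) ⟩
      p [] * (q [] * r (x ∷ w) + conv qₓ r w) + conv pₓ (conv q r) w
        ∎
      where
      pₓ = p ∘ (x ∷_)
      qₓ = q ∘ (x ∷_)

    conv-identityˡ : ∀ p w → conv (coeff (word [])) p w ≈ p w
    conv-identityˡ p []      = *-identityˡ _
    conv-identityˡ p (x ∷ w) =
      trans (+-cong (*-identityˡ _) (conv-zeroˡ p w)) (+-identityʳ _)

    conv-identityʳ : ∀ p w → conv p (coeff (word [])) w ≈ p w
    conv-identityʳ p []      = *-identityʳ _
    conv-identityʳ p (x ∷ w) =
      trans (+-cong (zeroʳ _) (conv-identityʳ _ w)) (+-identityˡ _)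

  -- A function on words is identified with the linear form on polynomials
  -- extending it.
  module _ (isAlgebra : IsAlgebra k polynomialAlgebra) where

    freeAlgebra : Algebra k (c ⊔ ℓ ⊔ x) (ℓ ⊔ x)
    freeAlgebra = record { rawAlgebra = polynomialAlgebra ; isAlgebra = isAlgebra }

    FreeSweedlerDual : Pred (Polynomial → Carrier) (c ⊔ ℓ ⊔ x)
    FreeSweedlerDual f = IsLinearForm k freeAlgebra f ×
      (∃[ n ] ∃ λ (lam : Matrix k 1 n) → ∃ λ (gam : Matrix k n 1) →
       ∃ λ (μ : List X → Matrix k n n) →
         MonoidMorphisms.IsMonoidHomomorphism
           (++-[]-rawMonoid X) (RawAlgebra.*-rawMonoid (matrixAlgebra k n)) μ ×
         (∀ w → f (word w) ≈ rowMatrixColumn k lam (μ w) gam))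

-- If f = λ μ(·) γ and g = λ′ ν(·) γ′, then x ⊗ y ↦ μ(x) ⊗ ν(y), with the
-- Kronecker product on the right, is a morphism of algebras on A ⊗ A because
-- (M M′) ⊗ (N N′) = (M ⊗ N)(M′ ⊗ N′) over a commutative k.  Composing it with Δ
-- represents the dual law by λ ⊗ λ′ and γ ⊗ γ′.  For k⟨X⟩, a representation of
-- the monoid X* is first extended linearly to a representation of the algebra.
module Submission where

open import Defs
open import Algebra.Bundles using (Semiring; CommutativeMonoid)
open import Algebra.Definitions using (Commutative)
import Algebra.Module.Construct.TensorUnit as TensorUnit
open import Algebra.Module.Bundles.Raw using (RawLeftSemimodule)
import Algebra.Module.Morphism.Construct.Composition as ModuleComposition
open import Algebra.Module.Morphism.Structures using (module LeftSemimoduleMorphisms)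
import Algebra.Morphism.Construct.Composition as Composition
open import Algebra.Morphism.Structures using (module MonoidMorphisms; module SemiringMorphisms)
import Algebra.Properties.CommutativeSemigroup as CommutativeSemigroupProperties
import Algebra.Properties.Semiring.Sum as Sum
open import Algebra.Structures using (IsSemiring)
open import Data.Fin.Base using (Fin; zero; suc; _↑ˡ_; _↑ʳ_; combine; quotient; remainder)
import Data.Fin.Properties as Fin
open import Data.List.Base
  using (List; []; _∷_; _++_; map; foldr; deduplicate; ++-[]-rawMonoid)
import Data.List.Membership.DecPropositional as DecMembership
open import Data.List.Membership.Propositional using (_∉_) renaming (_∈_ to _∈ₗ_)
open import Data.List.Membership.Propositional.Properties
  using (∈-deduplicate⁺; ∈-++⁺ˡ; ∈-++⁺ʳ)
open import Data.List.Properties using (≡-dec)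
open import Data.List.Relation.Unary.All using (lookup)
open import Data.List.Relation.Unary.AllPairs using (_∷_)
open import Data.List.Relation.Unary.Any using (here; there)
open import Data.List.Relation.Unary.Unique.Propositional using (Unique)
import Data.List.Relation.Unary.Unique.DecPropositional.Properties as Unique
open import Data.Nat.Base as ℕ using (ℕ)
open import Data.Product.Base using (_×_; _,_; proj₁; proj₂)
open import Function.Base using (_∘_)
open import Level using (Level)
open import Relation.Binary.Definitions using (DecidableEquality)
open import Relation.Binary.PropositionalEquality.Core as ≡ using (_≢_)
import Relation.Binary.Reasoning.Setoid as SetoidReasoning
open import Relation.Nullary using (yes; no; contradiction)
open import Relation.Unary using (_∈_)

private variable
  c ℓ a b ℓa ℓb x : Level
  m n p q r s : ℕ

-- Algebra homomorphisms and linear forms.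

module AlgebraHomomorphism {R : Set c} {A : RawAlgebra R a ℓa} {B : RawAlgebra R b ℓb}
  {φ : RawAlgebra.Carrier A → RawAlgebra.Carrier B} (h : IsAlgebraHomomorphism A B φ) where
  open IsAlgebraHomomorphism h public
  open SemiringMorphisms.IsSemiringHomomorphism isSemiringHomomorphism public
  open LeftSemimoduleMorphisms.IsLeftSemimoduleHomomorphism isLeftSemimoduleHomomorphism public
    using (*ₗ-homo)

module _ {R : Set c} (A : RawAlgebra R a ℓa) (B : RawAlgebra R b ℓb) where
  private
    module A = RawAlgebra A
    module B = RawAlgebra B

  -- `IsAlgebraHomomorphism` contains additivity twice, once in each component. Both copies are
  -- taken from the linear map, which leaves only products and the unit to be checked.
  linear∧multiplicative⇒algebraHomomorphism : {φ : A.Carrier → B.Carrier} →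
    LeftSemimoduleMorphisms.IsLeftSemimoduleHomomorphism A.rawLeftSemimodule B.rawLeftSemimodule φ →
    (∀ x y → φ (x A.* y) B.≈ φ x B.* φ y) →
    φ A.1# B.≈ B.1# →
    IsAlgebraHomomorphism A B φ
  linear∧multiplicative⇒algebraHomomorphism linear *-homo 1-homo = record
    { isSemiringHomomorphism = record
      { isNearSemiringHomomorphism = record
        { +-isMonoidHomomorphism =
            LeftSemimoduleMorphisms.IsLeftSemimoduleHomomorphism.+ᴹ-isMonoidHomomorphism linear
        ; *-homo = *-homo
        }
      ; 1#-homo = 1-homo
      }
    ; isLeftSemimoduleHomomorphism = linear
    }

module _ (k : Semiring c ℓ) (A : Algebra k a ℓa) where
  open Semiring k
  private module A = Algebra A

  linearForm-resp : {f g : A.Carrier → Carrier} → (∀ x → f x ≈ g x) →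
                    IsLinearForm k A g → IsLinearForm k A f
  linearForm-resp f≈g g-linear = record
    { +ᴹ-isMonoidHomomorphism = record
      { isMagmaHomomorphism = record
        { isRelHomomorphism = record
          { cong = λ x≈y → trans (f≈g _) (trans (g.⟦⟧-cong x≈y) (sym (f≈g _))) }
        ; homo = λ x y →
            trans (f≈g _) (trans (g.+ᴹ-homo x y) (+-cong (sym (f≈g x)) (sym (f≈g y))))
        }
      ; ε-homo = trans (f≈g _) g.0ᴹ-homo
      }
    ; *ₗ-homo = λ r x → trans (f≈g _) (trans (g.*ₗ-homo r x) (*-congˡ (sym (f≈g x))))
    }
    where module g = LeftSemimoduleMorphisms.IsLeftSemimoduleHomomorphism g-linear

-- Matrices and Kronecker products.

module Matrices (k : Semiring c ℓ) where
  open Semiring k hiding (zero)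
  open Sum k
  open SetoidReasoning setoid

  -- Rectangular shapes are included because multiplication by a row and then by a column leads from
  -- n×n matrices through 1×n matrices to 1×1 matrices.
  matrixModule : ℕ → ℕ → RawLeftSemimodule Carrier c ℓ
  matrixModule m n = record
    { Carrierᴹ = Matrix k m n
    ; _≈ᴹ_     = λ M N → ∀ i j → M i j ≈ N i j
    ; _+ᴹ_     = λ M N i j → M i j + N i j
    ; _*ₗ_     = λ r M i j → r * M i j
    ; 0ᴹ       = λ _ _ → 0#
    }

  module _ {m n : ℕ} where
    open RawLeftSemimodule (matrixModule m n) public
      using () renaming (_≈ᴹ_ to _≈ₘ_; _+ᴹ_ to _+ₘ_; _*ₗ_ to _·ₘ_; 0ᴹ to 0ₘ)

  infixl 7 _∙_
  _∙_ : Matrix k m n → Matrix k n p → Matrix k m p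
  _∙_ = _*ₘ_ k

  ∙-cong : {M M′ : Matrix k m n} {N N′ : Matrix k n p} →
           M ≈ₘ M′ → N ≈ₘ N′ → M ∙ N ≈ₘ M′ ∙ N′
  ∙-cong M≈ N≈ i j = sum-cong-≋ (λ l → *-cong (M≈ i l) (N≈ l j))

  ∙-zeroˡ : (N : Matrix k n p) → 0ₘ {m} ∙ N ≈ₘ 0ₘ
  ∙-zeroˡ {n = n} N i j = trans (sum-cong-≋ (λ l → zeroˡ (N l j))) (sum-replicate-zero n)

  ∙-zeroʳ : (M : Matrix k m n) → M ∙ 0ₘ {n} {p} ≈ₘ 0ₘ
  ∙-zeroʳ {n = n} M i j = trans (sum-cong-≋ (λ l → zeroʳ (M i l))) (sum-replicate-zero n)

  ∙-distribˡ : (M : Matrix k m n) (N P : Matrix k n p) → M ∙ (N +ₘ P) ≈ₘ M ∙ N +ₘ M ∙ P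
  ∙-distribˡ M N P i j =
    trans (sum-cong-≋ (λ l → distribˡ (M i l) (N l j) (P l j)))
      (∑-distrib-+ (λ l → M i l * N l j) (λ l → M i l * P l j))

  ∙-distribʳ : (P : Matrix k n p) (M N : Matrix k m n) → (M +ₘ N) ∙ P ≈ₘ M ∙ P +ₘ N ∙ P
  ∙-distribʳ P M N i j =
    trans (sum-cong-≋ (λ l → distribʳ (P l j) (M i l) (N i l)))
      (∑-distrib-+ (λ l → M i l * P l j) (λ l → N i l * P l j))

  sum-↑ : (f : Fin (m ℕ.+ n) → Carrier) → sum f ≈ sum (f ∘ (_↑ˡ n)) + sum (f ∘ (m ↑ʳ_))
  sum-↑ {ℕ.zero}  f = sym (+-identityˡ _)
  sum-↑ {ℕ.suc m} f = trans (+-congˡ (sum-↑ {m} (f ∘ suc))) (sym (+-assoc _ _ _))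

  -- `combine` enumerates `Fin (m * n)` as `m` consecutive blocks of length `n`; `sum-↑` splits off
  -- the first block and induction treats the others.
  sum-combine : (f : Fin (m ℕ.* n) → Carrier) →
                sum f ≈ sum (λ i → sum (λ j → f (combine {m} {n} i j)))
  sum-combine {ℕ.zero}      f = refl
  sum-combine {ℕ.suc m} {n} f =
    trans (sum-↑ {n} f) (+-congˡ (sum-combine {m} (f ∘ (n ↑ʳ_))))

  sum-* : (f : Fin m → Carrier) (g : Fin n → Carrier) →
          sum (λ i → sum (λ j → f i * g j)) ≈ sum f * sum g
  sum-* f g = trans
    (sum-cong-≋ (λ i → sym (*-distribˡ-sum (f i) g)))
    (sym (*-distribʳ-sum (sum g) f))

  infixl 7 _⊠_
  -- The Kronecker product. Each index is decoded into the number of its block and its position in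
  -- that block, which inverts `combine`.
  _⊠_ : Matrix k m n → Matrix k p q → Matrix k (m ℕ.* p) (n ℕ.* q)
  _⊠_ {m} {n} {p} {q} M N i j =
    M (quotient p i) (quotient q j) * N (remainder {m} p i) (remainder {n} q j)

  ⊠-cong : {M M′ : Matrix k m n} {N N′ : Matrix k p q} →
           M ≈ₘ M′ → N ≈ₘ N′ → M ⊠ N ≈ₘ M′ ⊠ N′
  ⊠-cong {m} {n} {p} {q} M≈ N≈ i j =
    *-cong (M≈ (quotient p i) (quotient q j)) (N≈ (remainder {m} p i) (remainder {n} q j))

  1ₘ : Matrix k n n
  1ₘ {n} = RawAlgebra.1# (matrixAlgebra k n)

  1ₘ-diagonal : (i : Fin n) → 1ₘ i i ≈ 1#
  1ₘ-diagonal i with i Fin.≟ i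
  ... | yes _  = refl
  ... | no i≢i = contradiction ≡.refl i≢i

  1ₘ⊠1ₘ : 1ₘ {m} ⊠ 1ₘ {n} ≈ₘ 1ₘ
  1ₘ⊠1ₘ {m} {n} i j with i Fin.≟ j
  ... | yes ≡.refl = trans
    (*-cong (1ₘ-diagonal (quotient {m} n i)) (1ₘ-diagonal (remainder {m} n i))) (*-identityˡ 1#)
  ... | no i≢j with quotient {m} n i Fin.≟ quotient n j | remainder {m} n i Fin.≟ remainder {m} n j
  ...   | no _  | _     = zeroˡ _
  ...   | yes _ | no _  = zeroʳ _
  -- Quotient and remainder together determine an index, so distinct indices cannot agree in both.
  ...   | yes e | yes e′ = contradiction
    (≡.trans (≡.sym (Fin.combine-remQuot {m} n i))
      (≡.trans (≡.cong₂ combine e e′) (Fin.combine-remQuot {m} n j)))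
    i≢j

  -- Composed with linear maps into matrices, this turns an identity of matrices into identities of
  -- linear forms, one for each entry.
  entry-linear : ∀ {m n} (i : Fin m) (j : Fin n) →
    LeftSemimoduleMorphisms.IsLeftSemimoduleHomomorphism
      (matrixModule m n) (TensorUnit.rawLeftSemimodule {R = rawSemiring}) (λ M → M i j)
  entry-linear i j = record
    { +ᴹ-isMonoidHomomorphism = record
      { isMagmaHomomorphism = record
        { isRelHomomorphism = record { cong = λ M≈N → M≈N i j }
        ; homo = λ _ _ → refl
        }
      ; ε-homo = refl
      }
    ; *ₗ-homo = λ _ _ → refl
    }

  -- Bilinearity and the mixed-product rule over a commutative semiring.

  module OverCommutative (*-comm : Commutative _≈_ _*_) where
    private
      *-commutativeMonoid : CommutativeMonoid c ℓ
      *-commutativeMonoid = record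
        { isCommutativeMonoid = record { isMonoid = *-isMonoid ; comm = *-comm } }
    open CommutativeSemigroupProperties
      (CommutativeMonoid.commutativeSemigroup *-commutativeMonoid)
      using (interchange; x∙yz≈y∙xz)

    ∙-scaleˡ : ∀ r (M : Matrix k m n) (N : Matrix k n p) → (r ·ₘ M) ∙ N ≈ₘ r ·ₘ (M ∙ N)
    ∙-scaleˡ r M N i j = trans (sum-cong-≋ (λ l → *-assoc r (M i l) (N l j)))
      (sym (*-distribˡ-sum r (λ l → M i l * N l j)))

    -- The scalar has to pass the entries of the left factor, which commutativity of `k` permits.
    ∙-scaleʳ : ∀ r (M : Matrix k m n) (N : Matrix k n p) → M ∙ (r ·ₘ N) ≈ₘ r ·ₘ (M ∙ N)
    ∙-scaleʳ r M N i j = trans (sum-cong-≋ (λ l → x∙yz≈y∙xz (M i l) r (N l j)))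
      (sym (*-distribˡ-sum r (λ l → M i l * N l j)))

    ∙-linearˡ : ∀ {m n p} (N : Matrix k n p) →
      LeftSemimoduleMorphisms.IsLeftSemimoduleHomomorphism
        (matrixModule m n) (matrixModule m p) (_∙ N)
    ∙-linearˡ N = record
      { +ᴹ-isMonoidHomomorphism = record
        { isMagmaHomomorphism = record
          { isRelHomomorphism = record { cong = λ M≈ → ∙-cong {N = N} M≈ (λ _ _ → refl) }
          ; homo = ∙-distribʳ N
          }
        ; ε-homo = ∙-zeroˡ N
        }
      ; *ₗ-homo = λ r M → ∙-scaleˡ r M N
      }

    ∙-linearʳ : ∀ {m n p} (M : Matrix k m n) →
      LeftSemimoduleMorphisms.IsLeftSemimoduleHomomorphism
        (matrixModule n p) (matrixModule m p) (M ∙_)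
    ∙-linearʳ M = record
      { +ᴹ-isMonoidHomomorphism = record
        { isMagmaHomomorphism = record
          { isRelHomomorphism = record { cong = λ N≈ → ∙-cong {M = M} (λ _ _ → refl) N≈ }
          ; homo = ∙-distribˡ M
          }
        ; ε-homo = ∙-zeroʳ M
        }
      ; *ₗ-homo = λ r N → ∙-scaleʳ r M N
      }

    -- A composite of three linear maps: left multiplication by `lam`, right multiplication by
    -- `gam`, and reading the single entry of a 1×1 matrix.
    rowMatrixColumn-linear : ∀ {n} (lam : Matrix k 1 n) (gam : Matrix k n 1) →
      LeftSemimoduleMorphisms.IsLeftSemimoduleHomomorphism
        (matrixModule n n) (TensorUnit.rawLeftSemimodule {R = rawSemiring})
        (λ M → rowMatrixColumn k lam M gam)
    rowMatrixColumn-linear lam gam =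
      ModuleComposition.isLeftSemimoduleHomomorphism trans (∙-linearʳ lam)
        (ModuleComposition.isLeftSemimoduleHomomorphism trans (∙-linearˡ gam)
          (entry-linear zero zero))

    -- The mixed-product rule. On the right the summation index is split into a pair, commutativity
    -- regroups each term, and the double sum then factors by `sum-*`.
    ⊠-∙ : (M : Matrix k m n) (M′ : Matrix k n r) (N : Matrix k p q) (N′ : Matrix k q s) →
          (M ∙ M′) ⊠ (N ∙ N′) ≈ₘ (M ⊠ N) ∙ (M′ ⊠ N′)
    ⊠-∙ {m} {n} {r} {p} {q} {s} M M′ N N′ i j = sym (begin
      sum (λ l → (M ⊠ N) i l * (M′ ⊠ N′) l j)
        ≈⟨ sum-combine {n} {q} (λ l → (M ⊠ N) i l * (M′ ⊠ N′) l j) ⟩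
      sum (λ u → sum (λ v → (M ⊠ N) i (combine {n} {q} u v) * (M′ ⊠ N′) (combine {n} {q} u v) j))
        ≈⟨ sum-cong-≋ (λ u → sum-cong-≋ (λ v → term u v)) ⟩
      sum (λ u → sum (λ v → (M i₁ u * M′ u j₁) * (N i₂ v * N′ v j₂)))
        ≈⟨ sum-* (λ u → M i₁ u * M′ u j₁) (λ v → N i₂ v * N′ v j₂) ⟩
      (M ∙ M′) i₁ j₁ * (N ∙ N′) i₂ j₂ ∎)
      where
      i₁ = quotient p i
      i₂ = remainder {m} p i
      j₁ = quotient s j
      j₂ = remainder {r} s j
      term : ∀ (u : Fin n) (v : Fin q) →
        (M ⊠ N) i (combine u v) * (M′ ⊠ N′) (combine u v) j
          ≈ (M i₁ u * M′ u j₁) * (N i₂ v * N′ v j₂)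
      -- `remQuot-combine` decodes `combine u v` into `u` and `v`; `interchange` then swaps the
      -- entries of `N` and `M′`.
      term u v = trans
        (reflexive (≡.cong (λ (u , v) → (M i₁ u * N i₂ v) * (M′ u j₁ * N′ v j₂))
          (Fin.remQuot-combine u v)))
        (interchange _ _ _ _)

    -- The matrix counterpart of the relation `·-⊗`, which moves scalars across the tensor sign.
    ⊠-scale : ∀ t (M : Matrix k m n) (N : Matrix k p q) → (t ·ₘ M) ⊠ N ≈ₘ M ⊠ (t ·ₘ N)
    ⊠-scale t M N i j = trans (*-assoc _ _ _) (sym (x∙yz≈y∙xz _ _ _))

    -- A product of two scalars is the entry of a 1×1 Kronecker product, since `1 * 1` computes to
    -- `1`. Two uses of the mixed-product rule split off first the columns and then the rows.
    rowMatrixColumn-⊠ : ∀ {m n} (lam : Matrix k 1 m) (M : Matrix k m m) (gam : Matrix k m 1)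
      (lam′ : Matrix k 1 n) (N : Matrix k n n) (gam′ : Matrix k n 1) →
      rowMatrixColumn k lam M gam * rowMatrixColumn k lam′ N gam′
        ≈ rowMatrixColumn k (lam ⊠ lam′) (M ⊠ N) (gam ⊠ gam′)
    rowMatrixColumn-⊠ lam M gam lam′ N gam′ = trans
      (⊠-∙ (lam ∙ M) gam (lam′ ∙ N) gam′ zero zero)
      (∙-cong {N = gam ⊠ gam′} (⊠-∙ lam M lam′ N) (λ _ _ → refl) zero zero)

-- Representations of the tensor square, and closure under the dual law.

module DualLaw (k : Semiring c ℓ) (*-comm : Commutative (Semiring._≈_ k) (Semiring._*_ k))
               (A : Algebra k a ℓa) where
  open Semiring k hiding (zero)
  open Matrices k
  open OverCommutative *-comm
  private
    module A  = Algebra A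
    module A² = RawAlgebra (tensorSquare k A)

  module _ {m n : ℕ} {μ : A.Carrier → Matrix k m m} {ν : A.Carrier → Matrix k n n}
           (μ-hom : IsAlgebraHomomorphism A.rawAlgebra (matrixAlgebra k m) μ)
           (ν-hom : IsAlgebraHomomorphism A.rawAlgebra (matrixAlgebra k n) ν) where
    private
      module μ = AlgebraHomomorphism μ-hom
      module ν = AlgebraHomomorphism ν-hom

    -- The map `μ ⊗ ν`, given on the lists that represent tensors; `tensorMatrix-cong` shows that it
    -- descends to the tensor square.
    tensorMatrix : A².Carrier → Matrix k (m ℕ.* n) (m ℕ.* n)
    tensorMatrix []            = 0ₘ
    tensorMatrix ((x , y) ∷ s) = μ x ⊠ ν y +ₘ tensorMatrix s

    tensorMatrix-++ : ∀ s t → tensorMatrix (s ++ t) ≈ₘ tensorMatrix s +ₘ tensorMatrix t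
    tensorMatrix-++ []      t i j = sym (+-identityˡ _)
    tensorMatrix-++ (_ ∷ s) t i j =
      trans (+-congˡ (tensorMatrix-++ s t i j)) (sym (+-assoc _ _ _))

    -- Induction on the derivation of `≈⊗`: the generating relations hold for Kronecker products
    -- because `⊠` is bilinear and `μ` and `ν` are linear.
    tensorMatrix-cong : ∀ {s t} → s A².≈ t → tensorMatrix s ≈ₘ tensorMatrix t
    tensorMatrix-cong ≈⊗-refl i j = refl
    tensorMatrix-cong (≈⊗-sym e) i j = sym (tensorMatrix-cong e i j)
    tensorMatrix-cong (≈⊗-trans e e′) i j =
      trans (tensorMatrix-cong e i j) (tensorMatrix-cong e′ i j)
    tensorMatrix-cong (++-cong {s} {s′} {t} {t′} e e′) i j =
      trans (tensorMatrix-++ s t i j)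
        (trans (+-cong (tensorMatrix-cong e i j) (tensorMatrix-cong e′ i j))
          (sym (tensorMatrix-++ s′ t′ i j)))
    tensorMatrix-cong (++-comm s t) i j =
      trans (tensorMatrix-++ s t i j)
        (trans (+-comm _ _) (sym (tensorMatrix-++ t s i j)))
    tensorMatrix-cong (⊗-cong x≈ y≈) i j =
      +-congʳ (⊠-cong (μ.⟦⟧-cong x≈) (ν.⟦⟧-cong y≈) i j)
    -- Every list contributes a final zero, so the claim has the form `(a + b) + 0 ≈ a + (b + 0)`.
    tensorMatrix-cong (+-⊗ x x′ y) i j =
      trans (+-congʳ (trans (*-congʳ (μ.+-homo x x′ _ _)) (distribʳ _ _ _))) (+-assoc _ _ _)
    tensorMatrix-cong (⊗-+ x y y′) i j =
      trans (+-congʳ (trans (*-congˡ (ν.+-homo y y′ _ _)) (distribˡ _ _ _))) (+-assoc _ _ _)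
    tensorMatrix-cong (0-⊗ y) i j =
      trans (+-identityʳ _) (trans (*-congʳ (μ.0#-homo _ _)) (zeroˡ _))
    tensorMatrix-cong (⊗-0 x) i j =
      trans (+-identityʳ _) (trans (*-congˡ (ν.0#-homo _ _)) (zeroʳ _))
    tensorMatrix-cong (·-⊗ r x y) i j = +-congʳ
      (trans (*-congʳ (μ.*ₗ-homo r x _ _))
        (trans (⊠-scale r (μ x) (ν y) i j) (*-congˡ (sym (ν.*ₗ-homo r y _ _)))))

    tensorMatrix-scale : ∀ r s → tensorMatrix (r A².· s) ≈ₘ r ·ₘ tensorMatrix s
    tensorMatrix-scale r []            i j = sym (zeroʳ r)
    tensorMatrix-scale r ((x , y) ∷ s) i j = trans
      (+-cong (trans (*-congʳ (μ.*ₗ-homo r x _ _)) (*-assoc _ _ _)) (tensorMatrix-scale r s i j))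
      (sym (distribˡ _ _ _))

    -- The mapped list is the block that `cartesianProductWith` builds from one left factor
    -- `(x , y)`; the mixed-product rule treats its terms one by one.
    tensorMatrix-pure* : ∀ x y t →
      tensorMatrix (map (λ (z , w) → x A.* z , y A.* w) t) ≈ₘ (μ x ⊠ ν y) ∙ tensorMatrix t
    tensorMatrix-pure* x y []            i j = sym (∙-zeroʳ (μ x ⊠ ν y) i j)
    tensorMatrix-pure* x y ((z , w) ∷ t) i j = trans
      (+-cong
        (trans (⊠-cong (μ.*-homo x z) (ν.*-homo y w) i j)
               (⊠-∙ (μ x) (μ z) (ν y) (ν w) i j))
        (tensorMatrix-pure* x y t i j))
      (sym (∙-distribˡ (μ x ⊠ ν y) (μ z ⊠ ν w) (tensorMatrix t) i j))

    tensorMatrix-* : ∀ s t → tensorMatrix (s A².* t) ≈ₘ tensorMatrix s ∙ tensorMatrix t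
    tensorMatrix-* []            t i j = sym (∙-zeroˡ (tensorMatrix t) i j)
    tensorMatrix-* ((x , y) ∷ s) t i j = trans
      (tensorMatrix-++ (map (λ (z , w) → x A.* z , y A.* w) t) (s A².* t) i j)
      (trans (+-cong (tensorMatrix-pure* x y t i j) (tensorMatrix-* s t i j))
        (sym (∙-distribʳ (tensorMatrix t) (μ x ⊠ ν y) (tensorMatrix s) i j)))

    tensorMatrix-homomorphism :
      IsAlgebraHomomorphism (tensorSquare k A) (matrixAlgebra k (m ℕ.* n)) tensorMatrix
    tensorMatrix-homomorphism =
      linear∧multiplicative⇒algebraHomomorphism (tensorSquare k A) (matrixAlgebra k (m ℕ.* n))
        record
          { +ᴹ-isMonoidHomomorphism = record
            { isMagmaHomomorphism = record
              { isRelHomomorphism = record { cong = tensorMatrix-cong }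
              ; homo = tensorMatrix-++
              }
            ; ε-homo = λ _ _ → refl
            }
          ; *ₗ-homo = tensorMatrix-scale
          }
        tensorMatrix-*
        -- The unit tensor is a one-element list, so its matrix is a Kronecker product of identity
        -- matrices plus a final zero.
        (λ i j → trans (+-identityʳ _)
          (trans (⊠-cong μ.1#-homo ν.1#-homo i j) (1ₘ⊠1ₘ {m} {n} i j)))

    -- For a pure tensor this is `rowMatrixColumn-⊠`; additivity of `rowMatrixColumn` in its matrix
    -- then handles sums.
    tensorForm-tensorMatrix : ∀ {f g : A.Carrier → Carrier}
      {lam : Matrix k 1 m} {gam : Matrix k m 1} {lam′ : Matrix k 1 n} {gam′ : Matrix k n 1} →
      (∀ x → f x ≈ rowMatrixColumn k lam (μ x) gam) →
      (∀ x → g x ≈ rowMatrixColumn k lam′ (ν x) gam′) →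
      ∀ s → tensorForm k A f g s ≈ rowMatrixColumn k (lam ⊠ lam′) (tensorMatrix s) (gam ⊠ gam′)
    tensorForm-tensorMatrix {lam = lam} {gam} {lam′} {gam′} f≈ g≈ = go
      where
      module rmc = LeftSemimoduleMorphisms.IsLeftSemimoduleHomomorphism
        (rowMatrixColumn-linear (lam ⊠ lam′) (gam ⊠ gam′))
      go : ∀ s → _
      go []            = sym rmc.0ᴹ-homo
      go ((x , y) ∷ s) = trans
        (+-cong (trans (*-cong (f≈ x) (g≈ y)) (rowMatrixColumn-⊠ lam (μ x) gam lam′ (ν y) gam′))
                (go s))
        (sym (rmc.+ᴹ-homo (μ x ⊠ ν y) (tensorMatrix s)))

  dualLaw-closed : ∀ {Δ} → IsAlgebraHomomorphism A.rawAlgebra (tensorSquare k A) Δ →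
    ∀ {f g} → f ∈ SweedlerDual k A → g ∈ SweedlerDual k A → dualLaw k A Δ f g ∈ SweedlerDual k A
  dualLaw-closed {Δ} Δ-hom {f} {g}
    (_ , m , lam , gam , μ , μ-hom , f≈) (_ , n , lam′ , gam′ , ν , ν-hom , g≈) =
    linear , m ℕ.* n , lam ⊠ lam′ , gam ⊠ gam′ , T ∘ Δ , T∘Δ-hom , represents
    where
    T = tensorMatrix μ-hom ν-hom

    represents : ∀ x →
      dualLaw k A Δ f g x ≈ rowMatrixColumn k (lam ⊠ lam′) (T (Δ x)) (gam ⊠ gam′)
    represents x = tensorForm-tensorMatrix μ-hom ν-hom
      {lam = lam} {gam} {lam′} {gam′} f≈ g≈ (Δ x)

    T-hom = tensorMatrix-homomorphism μ-hom ν-hom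

    ≈ₘ-trans : {M N P : Matrix k (m ℕ.* n) (m ℕ.* n)} → M ≈ₘ N → N ≈ₘ P → M ≈ₘ P
    ≈ₘ-trans M≈N N≈P i j = trans (M≈N i j) (N≈P i j)

    T∘Δ-hom : IsAlgebraHomomorphism A.rawAlgebra (matrixAlgebra k (m ℕ.* n)) (T ∘ Δ)
    T∘Δ-hom = record
      { isSemiringHomomorphism = Composition.isSemiringHomomorphism
          (λ {M} {N} {P} → ≈ₘ-trans {M} {N} {P})
          (AlgebraHomomorphism.isSemiringHomomorphism Δ-hom)
          (AlgebraHomomorphism.isSemiringHomomorphism T-hom)
      ; isLeftSemimoduleHomomorphism = ModuleComposition.isLeftSemimoduleHomomorphism
          (λ {M} {N} {P} → ≈ₘ-trans {M} {N} {P})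
          (AlgebraHomomorphism.isLeftSemimoduleHomomorphism Δ-hom)
          (AlgebraHomomorphism.isLeftSemimoduleHomomorphism T-hom)
      }

    linear : IsLinearForm k A (dualLaw k A Δ f g)
    -- Linearity is read off from the matrix representation, a composite of linear maps.
    linear = linearForm-resp k A represents
      (ModuleComposition.isLeftSemimoduleHomomorphism trans
        (IsAlgebraHomomorphism.isLeftSemimoduleHomomorphism T∘Δ-hom)
        (rowMatrixColumn-linear (lam ⊠ lam′) (gam ⊠ gam′)))

-- Polynomials: finite sums over lists of words.

module Free (k : Semiring c ℓ) {X : Set x} (_≟_ : DecidableEquality X)
            (isAlgebra : IsAlgebra k (polynomialAlgebra k _≟_)) where
  open Semiring k hiding (zero)
  open Polynomial
  open CommutativeSemigroupProperties
    (CommutativeMonoid.commutativeSemigroup +-commutativeMonoid) using (interchange)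
  private
    *-comm = isAlgebra⇒comm k _≟_ isAlgebra
    A = freeAlgebra k _≟_ isAlgebra
    module A = Algebra A
    module A≈ = IsSemiring A.isSemiring
    _≟ʷ_ = ≡-dec _≟_
    δ = word k _≟_
    Poly = Polynomial k _≟_
  open Matrices k
  open OverCommutative *-comm
  open DecMembership _≟ʷ_ using (_∈?_)

  ∑ : List (List X) → (List X → Carrier) → Carrier
  ∑ S F = foldr (λ w s → F w + s) 0# S

  ∑-cong : ∀ S {F G} → (∀ w → F w ≈ G w) → ∑ S F ≈ ∑ S G
  ∑-cong []      F≈G = refl
  ∑-cong (w ∷ S) F≈G = +-cong (F≈G w) (∑-cong S F≈G)

  ∑-zero : ∀ S → ∑ S (λ _ → 0#) ≈ 0#
  ∑-zero []      = refl
  ∑-zero (w ∷ S) = trans (+-identityˡ _) (∑-zero S)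

  ∑-+ : ∀ S F G → ∑ S (λ w → F w + G w) ≈ ∑ S F + ∑ S G
  ∑-+ []      F G = sym (+-identityˡ _)
  ∑-+ (w ∷ S) F G = trans (+-congˡ (∑-+ S F G)) (interchange _ _ _ _)

  ∑-scale : ∀ S r F → ∑ S (λ w → r * F w) ≈ r * ∑ S F
  ∑-scale []      r F = sym (zeroʳ r)
  ∑-scale (w ∷ S) r F = trans (+-congˡ (∑-scale S r F)) (sym (distribˡ _ _ _))

  ∑-comm : ∀ S T (F : List X → List X → Carrier) →
           ∑ S (λ u → ∑ T (F u)) ≈ ∑ T (λ v → ∑ S (λ u → F u v))
  ∑-comm []      T F = sym (∑-zero T)
  ∑-comm (u ∷ S) T F = trans (+-congˡ (∑-comm S T F)) (sym (∑-+ T (F u) _))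

  -- Indicator functions of words.

  δ-same : ∀ w → coeff (δ w) w ≈ 1#
  δ-same w with w ≟ʷ w
  ... | yes _  = refl
  ... | no w≢w = contradiction ≡.refl w≢w

  δ-distinct : ∀ {u w} → w ≢ u → coeff (δ u) w ≈ 0#
  δ-distinct {u} {w} w≢u with w ≟ʷ u
  ... | yes w≡u = contradiction w≡u w≢u
  ... | no _    = refl

  -- Both sides vanish unless the two words agree, and then they coincide. This symmetry lets a
  -- double sum be collapsed along either index.
  *-δ-sym : ∀ (F : List X → Carrier) u w → F u * coeff (δ u) w ≈ F w * coeff (δ w) u
  *-δ-sym F u w with w ≟ʷ u
  ... | yes ≡.refl = *-congˡ (sym (δ-same u))
  ... | no w≢u     =
    trans (zeroʳ _) (sym (trans (*-congˡ (δ-distinct (w≢u ∘ ≡.sym))) (zeroʳ _)))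

  ∑-δ-∉ : ∀ {S w} (F : List X → Carrier) → w ∉ S → ∑ S (λ u → F u * coeff (δ u) w) ≈ 0#
  ∑-δ-∉ {[]}    F w∉ = refl
  ∑-δ-∉ {u ∷ S} F w∉ = trans
    (+-cong (trans (*-congˡ (δ-distinct (w∉ ∘ here))) (zeroʳ _)) (∑-δ-∉ F (w∉ ∘ there)))
    (+-identityˡ 0#)

  -- Only summands at `w` can survive. As `S` has no repetitions there is just one of them; a
  -- repeated word would count `F w` several times.
  ∑-δ-∈ : ∀ {S w} (F : List X → Carrier) → Unique S → w ∈ₗ S →
          ∑ S (λ u → F u * coeff (δ u) w) ≈ F w
  ∑-δ-∈ {u ∷ S} F (u∉ ∷ _) (here ≡.refl) = trans
    (+-cong (trans (*-congˡ (δ-same u)) (*-identityʳ _))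
            (∑-δ-∉ F (λ u∈S → lookup u∉ u∈S ≡.refl)))
    (+-identityʳ _)
  ∑-δ-∈ {u ∷ S} F (u∉ ∷ S!) (there w∈S) = trans
    (+-cong (trans (*-congˡ (δ-distinct (λ w≡u → lookup u∉ w∈S (≡.sym w≡u)))) (zeroʳ _))
            (∑-δ-∈ F S! w∈S))
    (+-identityˡ _)

  -- On `S` this is `∑-δ-∈`; off `S` both sides vanish. Thus `F` is a finite combination of
  -- indicator functions.
  ∑-δ : ∀ {S} (F : List X → Carrier) → Unique S → (∀ w → w ∉ S → F w ≈ 0#) →
        ∀ w → ∑ S (λ u → F u * coeff (δ u) w) ≈ F w
  ∑-δ {S} F S! F-vanish w with w ∈? S
  ... | yes w∈S = ∑-δ-∈ F S! w∈S
  ... | no  w∉S = trans (∑-δ-∉ F w∉S) (sym (F-vanish w w∉S))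

  -- ∑ S F and ∑ T F both equal the double sum of F u * δ u w over S × T.
  ∑-support-irrelevant : ∀ {S T} F → Unique S → Unique T →
    (∀ w → w ∉ S → F w ≈ 0#) → (∀ w → w ∉ T → F w ≈ 0#) → ∑ S F ≈ ∑ T F
  ∑-support-irrelevant {S} {T} F S! T! F-S F-T = begin
    ∑ S F                                            ≈⟨ ∑-cong S (∑-δ F T! F-T) ⟨
    ∑ S (λ w → ∑ T (λ u → F u * coeff (δ u) w))      ≈⟨ ∑-comm S T _ ⟩
    ∑ T (λ u → ∑ S (λ w → F u * coeff (δ u) w))
      ≈⟨ ∑-cong T (λ u → ∑-cong S (λ w → *-δ-sym F u w)) ⟩
    ∑ T (λ u → ∑ S (λ w → F w * coeff (δ w) u))      ≈⟨ ∑-cong T (∑-δ F S! F-S) ⟩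
    ∑ T F                                            ∎
    where open SetoidReasoning setoid

  -- The support of a polynomial may list a word twice.
  supp : Poly → List (List X)
  supp p = deduplicate _≟ʷ_ (support p)

  supp-unique : ∀ p → Unique (supp p)
  supp-unique p = Unique.deduplicate-! _≟ʷ_ (support p)

  supp-vanish : ∀ p w → w ∉ supp p → coeff p w ≈ 0#
  supp-vanish p w w∉ = vanish p w (w∉ ∘ ∈-deduplicate⁺ _≟ʷ_)

  -- Linear extension from words to polynomials.

  extend : (List X → Carrier) → Poly → Carrier
  extend φ p = ∑ (supp p) (λ w → coeff p w * φ w)

  -- Equality of polynomials ignores their support lists. This makes it possible to sum several
  -- polynomials over one common list.
  extend-over : ∀ {S} φ p → Unique S → (∀ w → w ∉ S → coeff p w ≈ 0#) →
                extend φ p ≈ ∑ S (λ w → coeff p w * φ w)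
  extend-over φ p S! p-vanish = ∑-support-irrelevant _ (supp-unique p) S!
    (λ w w∉ → trans (*-congʳ (supp-vanish p w w∉)) (zeroˡ _))
    (λ w w∉ → trans (*-congʳ (p-vanish w w∉)) (zeroˡ _))

  extend-linear : ∀ φ → IsLinearForm k A (extend φ)
  extend-linear φ = record
    { +ᴹ-isMonoidHomomorphism = record
      { isMagmaHomomorphism = record
        { isRelHomomorphism = record { cong = λ {p} {q} → cong {p} {q} }
        ; homo = homo
        }
      ; ε-homo = refl
      }
    -- Scaling keeps the support list, so both sides run over the same words.
    ; *ₗ-homo = λ r p → trans (∑-cong (supp p) (λ w → *-assoc _ _ _)) (∑-scale (supp p) r _)
    }
    where
    cong : ∀ {p q} → p A.≈ q → extend φ p ≈ extend φ q
    -- The sum for `q` is moved to the support of `p`, outside which the coefficients of `q` vanish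
    -- as well.
    cong {p} {q} p≈q = trans (∑-cong (supp p) (λ w → *-congʳ (p≈q w)))
      (sym (extend-over φ q (supp-unique p) (λ w w∉ → trans (sym (p≈q w)) (supp-vanish p w w∉))))

    homo : ∀ p q → extend φ (p A.+ q) ≈ extend φ p + extend φ q
    -- All three sums are taken over the support of the sum, which contains both other supports.
    homo p q = trans (∑-cong S (λ w → distribʳ _ _ _)) (trans (∑-+ S _ _) (+-cong
      (sym (extend-over φ p (supp-unique (p A.+ q))
        (λ w w∉ → vanish p w (w∉ ∘ ∈-deduplicate⁺ _≟ʷ_ ∘ ∈-++⁺ˡ))))
      (sym (extend-over φ q (supp-unique (p A.+ q))
        (λ w w∉ → vanish q w (w∉ ∘ ∈-deduplicate⁺ _≟ʷ_ ∘ ∈-++⁺ʳ (support p)))))))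
      where S = supp (p A.+ q)

  extend-word : ∀ φ w → extend φ (δ w) ≈ φ w
  extend-word φ w = trans (+-identityʳ _) (trans (*-congʳ (δ-same w)) (*-identityˡ _))

  -- By `∑-δ`, a polynomial equals the combination of the words in its support with its coefficients
  -- as weights. `F` respects this equality and can be evaluated term by term.
  linearForm-extend : ∀ {F} → IsLinearForm k A F → ∀ p → F p ≈ extend (F ∘ δ) p
  linearForm-extend {F} F-linear p = trans
    (F.⟦⟧-cong (λ w → sym (trans (coeff-combination (supp p) w)
      (∑-δ (coeff p) (supp-unique p) (supp-vanish p) w))))
    (F-combination (supp p))
    where
    module F = LeftSemimoduleMorphisms.IsLeftSemimoduleHomomorphism F-linear
    combination : List (List X) → Poly
    combination = foldr (λ w q → coeff p w A.· δ w A.+ q) A.0#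

    coeff-combination : ∀ S w →
      coeff (combination S) w ≈ ∑ S (λ u → coeff p u * coeff (δ u) w)
    coeff-combination []      w = refl
    coeff-combination (u ∷ S) w = +-congˡ (coeff-combination S w)

    F-combination : ∀ S → F (combination S) ≈ ∑ S (λ w → coeff p w * F (δ w))
    F-combination []      = F.0ᴹ-homo
    F-combination (w ∷ S) = trans (F.+ᴹ-homo _ _) (+-cong (F.*ₗ-homo _ _) (F-combination S))

  -- Words span the polynomials: by `linearForm-extend` each form is the extension of its
  -- restriction to words.
  linearForm-ext : ∀ {F G} → IsLinearForm k A F → IsLinearForm k A G →
                   (∀ w → F (δ w) ≈ G (δ w)) → ∀ p → F p ≈ G p
  linearForm-ext F-linear G-linear F≈G p = trans (linearForm-extend F-linear p)
    (trans (∑-cong (supp p) (λ w → *-congˡ (F≈G w))) (sym (linearForm-extend G-linear p)))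

  -- Products of words and bilinearity of multiplication.

  convolution-zeroˡ : ∀ (q : List X → Carrier) w → convolution k _≟_ (λ _ → 0#) q w ≈ 0#
  convolution-zeroˡ q []      = zeroˡ _
  convolution-zeroˡ q (x ∷ w) = trans (+-cong (zeroˡ _) (convolution-zeroˡ q w)) (+-identityˡ 0#)

  -- Induction on `u` along the recursion of the convolution. For `u` nonempty the factorisation
  -- with empty left part contributes zero; removing the first letter leaves the indicator of the
  -- tail of `u` if that letter matches, and zero otherwise.
  word-++ : ∀ u v → δ (u ++ v) A.≈ δ u A.* δ v
  word-++ []      v w       = sym (proj₁ A≈.*-identity (δ v) w)
  word-++ (y ∷ u) v []      = sym (zeroˡ _)
  word-++ (y ∷ u) v (x ∷ w) with x ≟ y
  ... | yes ≡.refl = trans (word-++ u v w) (sym (trans (+-congʳ (zeroˡ _)) (+-identityˡ _)))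
  ... | no _       = sym (trans (+-congʳ (zeroˡ _))
    (trans (+-identityˡ _) (convolution-zeroˡ (coeff (δ v)) w)))

  *-linearˡ : ∀ q → LeftSemimoduleMorphisms.IsLeftSemimoduleHomomorphism
    A.rawLeftSemimodule A.rawLeftSemimodule (A._* q)
  *-linearˡ q = record
    { +ᴹ-isMonoidHomomorphism = record
      { isMagmaHomomorphism = record
        { isRelHomomorphism = record
          { cong = λ {p} {p′} p≈p′ → A≈.*-cong {p} {p′} {q} {q} p≈p′ (λ _ → refl) }
        ; homo = λ p p′ → proj₂ A≈.distrib q p p′
        }
      ; ε-homo = proj₁ A≈.zero q
      }
    ; *ₗ-homo = λ r p → A.·-*-assocˡ r p q
    }

  *-linearʳ : ∀ p → LeftSemimoduleMorphisms.IsLeftSemimoduleHomomorphism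
    A.rawLeftSemimodule A.rawLeftSemimodule (p A.*_)
  *-linearʳ p = record
    { +ᴹ-isMonoidHomomorphism = record
      { isMagmaHomomorphism = record
        { isRelHomomorphism = record
          { cong = λ {q} {q′} q≈q′ → A≈.*-cong {p} {p} {q} {q′} (λ _ → refl) q≈q′ }
        ; homo = λ q q′ → proj₁ A≈.distrib p q q′
        }
      ; ε-homo = proj₂ A≈.zero p
      }
    ; *ₗ-homo = λ r q → A.·-*-assocʳ r p q
    }

  -- From representations of the monoid of words to representations of the algebra.

  module _ {n : ℕ} (μ : List X → Matrix k n n) where

    extendMatrix : Poly → Matrix k n n
    extendMatrix p i j = extend (λ w → μ w i j) p

    private
      module E {i j} = LeftSemimoduleMorphisms.IsLeftSemimoduleHomomorphism
        (extend-linear (λ w → μ w i j))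

    extendMatrix-linear : LeftSemimoduleMorphisms.IsLeftSemimoduleHomomorphism
      A.rawLeftSemimodule (matrixModule n n) extendMatrix
    extendMatrix-linear = record
      { +ᴹ-isMonoidHomomorphism = record
        { isMagmaHomomorphism = record
          { isRelHomomorphism = record { cong = λ {p} {q} p≈q i j → E.⟦⟧-cong {i} {j} {p} {q} p≈q }
          ; homo = λ p q i j → E.+ᴹ-homo {i} {j} p q
          }
        ; ε-homo = λ i j → refl
        }
      ; *ₗ-homo = λ r p i j → E.*ₗ-homo {i} {j} r p
      }

    extendMatrix-word : ∀ w → extendMatrix (δ w) ≈ₘ μ w
    extendMatrix-word w i j = extend-word (λ w → μ w i j) w

    module _ (μ-hom : MonoidMorphisms.IsMonoidHomomorphism
                (++-[]-rawMonoid X) (RawAlgebra.*-rawMonoid (matrixAlgebra k n)) μ) where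
      private module μ = MonoidMorphisms.IsMonoidHomomorphism μ-hom

      -- A product of words is again a word, on which the extension agrees with `μ`;
      -- multiplicativity of `μ` then suffices.
      extendMatrix-*-words : ∀ u v →
        extendMatrix (δ u A.* δ v) ≈ₘ extendMatrix (δ u) ∙ extendMatrix (δ v)
      extendMatrix-*-words u v i j = begin
        extendMatrix (δ u A.* δ v) i j
          ≈⟨ E.⟦⟧-cong {i} {j} {δ (u ++ v)} {δ u A.* δ v} (word-++ u v) ⟨
        extendMatrix (δ (u ++ v)) i j                  ≈⟨ extendMatrix-word (u ++ v) i j ⟩
        μ (u ++ v) i j                                 ≈⟨ μ.homo u v i j ⟩
        (μ u ∙ μ v) i j
          ≈⟨ ∙-cong (extendMatrix-word u) (extendMatrix-word v) i j ⟨
        (extendMatrix (δ u) ∙ extendMatrix (δ v)) i j  ∎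
        where open SetoidReasoning setoid

      -- Both sides are linear in p and in q, so it suffices to compare them on words.
      extendMatrix-* : ∀ p q → extendMatrix (p A.* q) ≈ₘ extendMatrix p ∙ extendMatrix q
      extendMatrix-* p q i j = linearForm-ext
        (ModuleComposition.isLeftSemimoduleHomomorphism trans
          (*-linearˡ q) (extend-linear (λ w → μ w i j)))
        (ModuleComposition.isLeftSemimoduleHomomorphism trans extendMatrix-linear
          (ModuleComposition.isLeftSemimoduleHomomorphism trans
            (∙-linearˡ (extendMatrix q)) (entry-linear i j)))
        (λ u → linearForm-ext
          (ModuleComposition.isLeftSemimoduleHomomorphism trans
            (*-linearʳ (δ u)) (extend-linear (λ w → μ w i j)))
          (ModuleComposition.isLeftSemimoduleHomomorphism trans extendMatrix-linear
            (ModuleComposition.isLeftSemimoduleHomomorphism trans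
              (∙-linearʳ (extendMatrix (δ u))) (entry-linear i j)))
          (λ v → extendMatrix-*-words u v i j)
          q)
        p

      extendMatrix-homomorphism : IsAlgebraHomomorphism A.rawAlgebra (matrixAlgebra k n) extendMatrix
      extendMatrix-homomorphism =
        linear∧multiplicative⇒algebraHomomorphism A.rawAlgebra (matrixAlgebra k n)
          extendMatrix-linear
          extendMatrix-*
          -- The unit polynomial is the empty word, which `μ` sends to the identity matrix.
          (λ i j → trans (extendMatrix-word [] i j) (μ.ε-homo i j))

  -- Agreement of the two descriptions of the Sweedler dual.

  free⇒sweedler : ∀ {f} → f ∈ FreeSweedlerDual k _≟_ isAlgebra → f ∈ SweedlerDual k A
  free⇒sweedler {f} (f-linear , n , lam , gam , μ , μ-hom , f≈) =
    f-linear , n , lam , gam , extendMatrix μ , extendMatrix-homomorphism μ μ-hom ,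
    -- The representation of `f` is given on words only; both sides being linear forms, it holds on
    -- all polynomials.
    linearForm-ext f-linear
      (ModuleComposition.isLeftSemimoduleHomomorphism trans
        (extendMatrix-linear μ) (rowMatrixColumn-linear lam gam))
      (λ w → trans (f≈ w) (rmc.⟦⟧-cong (λ i j → sym (extendMatrix-word μ w i j))))
    where
    module rmc = LeftSemimoduleMorphisms.IsLeftSemimoduleHomomorphism
      (rowMatrixColumn-linear lam gam)

  -- The representation is restricted along `δ`, which is a morphism of monoids from words to
  -- polynomials by `word-++`.
  sweedler⇒free : ∀ {f} → f ∈ SweedlerDual k A → f ∈ FreeSweedlerDual k _≟_ isAlgebra
  sweedler⇒free (f-linear , n , lam , gam , μ , μ-hom , f≈) =
    f-linear , n , lam , gam , μ ∘ δ ,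
    record
      { isMagmaHomomorphism = record
        { isRelHomomorphism = record { cong = λ { ≡.refl i j → refl } }
        ; homo = λ u v i j →
            trans (μ.⟦⟧-cong {δ (u ++ v)} {δ u A.* δ v} (word-++ u v) i j) (μ.*-homo (δ u) (δ v) i j)
        }
      ; ε-homo = μ.1#-homo
      } ,
    f≈ ∘ δ
    where module μ = AlgebraHomomorphism μ-hom

theorem6p1 :
  ∀ {c ℓ a ℓa x : Level} →
    ( (k : Field c ℓ) →
      let k′ = Field.semiring k in
      (A : Algebra k′ a ℓa) →
      (Δ : Algebra.Carrier A → RawAlgebra.Carrier (tensorSquare k′ A)) →
      IsAlgebraHomomorphism (Algebra.rawAlgebra A) (tensorSquare k′ A) Δ →
      ∀ f g →
      f ∈ SweedlerDual k′ A →
      g ∈ SweedlerDual k′ A →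
      dualLaw k′ A Δ f g ∈ SweedlerDual k′ A )
    ×
    ( (k : Semiring c ℓ) (X : Set x) (_≟_ : DecidableEquality X) →
      (isAlgebra : IsAlgebra k (polynomialAlgebra k _≟_)) →
      let A = freeAlgebra k _≟_ isAlgebra in
      (Δ : Algebra.Carrier A → RawAlgebra.Carrier (tensorSquare k A)) →
      IsAlgebraHomomorphism (Algebra.rawAlgebra A) (tensorSquare k A) Δ →
      ∀ f g →
      f ∈ FreeSweedlerDual k _≟_ isAlgebra →
      g ∈ FreeSweedlerDual k _≟_ isAlgebra →
      dualLaw k A Δ f g ∈ FreeSweedlerDual k _≟_ isAlgebra )
theorem6p1 =
  (λ k A Δ Δ-hom f g f∈ g∈ →
    DualLaw.dualLaw-closed (Field.semiring k) (Field.*-comm k) A Δ-hom f∈ g∈) ,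
  -- Commutativity of `k` comes from the algebra structure on polynomials. The closure is proved for
  -- representations of the algebra and carried back to representations of words.
  (λ k X _≟_ isAlgebra Δ Δ-hom f g f∈ g∈ →
    let open Free k _≟_ isAlgebra in
    sweedler⇒free
      (DualLaw.dualLaw-closed k (isAlgebra⇒comm k _≟_ isAlgebra) (freeAlgebra k _≟_ isAlgebra)
        Δ-hom (free⇒sweedler f∈) (free⇒sweedler g∈)))
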